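{- Let $\mathrm{a}_{n,k}^{\mathrm{asc}}(132,321)$ (respectively $\mathrm{a}_{n,k}^{\mathrm{des}}(132,321)$) denote the number of permutations of $\{1,\dots,n\}$ that avoid both $132$ and $321$ and have exactly $k$ ascents (respectively $k$ descents). Then for all integers $n\ge1$ and $k\ge0$, $$\mathrm{a}_{n,k}^{\mathrm{asc}}(132,321)=\begin{cases}1,&k=n-1;\\ \binom{n}{2},&k=n-2;\\ 0,&\text{otherwise},\end{cases}$$ and $$\mathrm{a}_{n,k}^{\mathrm{des}}(132,321)=\begin{cases}1,&k=0;\\ \binom{n}{2},&k=1;\\ 0,&\text{otherwise}.\end{cases}$$
   Context: $\mathcal{S}_n$ is the set of permutations $\pi=\pi_1\cdots\pi_n$ of $\{1,\dots,n\}$. For $\rho\in\mathcal{S}_m$, $\pi\in\mathcal{S}_n$ contains $\rho$ if there are indices $1\le i_1<\cdots<i_m\le n$ such that $\pi_{i_a}<\pi_{i_b}$ if and only if $\rho_a<\rho_b$; otherwise $\pi$ avoids $\rho$. The number of ascents is $\mathrm{asc}(\pi)=|\{i:\pi_i<\pi_{i+1}\}|$ and the number of descents is $\mathrm{des}(\pi)=|\{i:\pi_i>\pi_{i+1}\}|$, where $1\le i\le n-1$. -}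

module Defs where

open import Data.Fin using (Fin; suc; inject₁; _<_)
open import Data.Fin.Patterns using (0F; 1F; 2F)
open import Data.Fin.Permutation
  using (Permutation′; _⟨$⟩ʳ_; _≈_; transpose; reverse)
open import Data.Fin.Properties using (_<?_)
open import Data.List using (allFin; filter; length)
open import Data.Nat using (ℕ; zero; suc)
open import Data.Product using (Σ-syntax; _×_; proj₁)
open import Data.Vec using (_∷_; []; tabulate)
open import Function using (_⇔_; Inverse)
open import Level using (Level; 0ℓ; _⊔_)
open import Relation.Binary using (Setoid)
open import Relation.Binary.PropositionalEquality using (_≡_; refl; sym; trans; setoid)
open import Relation.Nullary using (¬_)

private
  variable
    m n : ℕ
    c ℓ : Level

-- Positions and values are 0-based: i ↦ π ⟨$⟩ʳ i is the word π₁⋯πₙ shifted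
-- down by one.

asc : Permutation′ n → ℕ
asc {zero}  π = 0
asc {suc n} π =
  length (filter (λ i → (π ⟨$⟩ʳ inject₁ i) <? (π ⟨$⟩ʳ suc i)) (allFin n))

des : Permutation′ n → ℕ
des {zero}  π = 0
des {suc n} π =
  length (filter (λ i → (π ⟨$⟩ʳ suc i) <? (π ⟨$⟩ʳ inject₁ i)) (allFin n))

_Contains_ : Permutation′ n → Permutation′ m → Set
_Contains_ {n} {m} π ρ =
  Σ[ ι ∈ (Fin m → Fin n) ]
    (∀ a b → a < b → ι a < ι b) ×
    (∀ a b → (π ⟨$⟩ʳ ι a < π ⟨$⟩ʳ ι b) ⇔ (ρ ⟨$⟩ʳ a < ρ ⟨$⟩ʳ b))

_Avoids_ : Permutation′ n → Permutation′ m → Set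
π Avoids ρ = ¬ (π Contains ρ)

p132 p321 : Permutation′ 3
p132 = transpose 1F 2F
p321 = reverse

p132-word : tabulate (p132 ⟨$⟩ʳ_) ≡ 0F ∷ 2F ∷ 1F ∷ []
p132-word = refl

p321-word : tabulate (p321 ⟨$⟩ʳ_) ≡ 2F ∷ 1F ∷ 0F ∷ []
p321-word = refl

-- Permutations are compared by their values only: without function
-- extensionality, _≡_ on Permutation′ n would be too fine for counting.
PermutationsWith : (Permutation′ n → Set) → Setoid 0ℓ 0ℓ
PermutationsWith {n} P = record
  { Carrier       = Σ[ π ∈ Permutation′ n ] P π
  ; _≈_           = λ x y → proj₁ x ≈ proj₁ y
  ; isEquivalence = record
    { refl  = λ _ → refl
    ; sym   = λ p i → sym (p i)
    ; trans = λ p q i → trans (p i) (q i)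
    }
  }

∣_∣≡_ : Setoid c ℓ → ℕ → Set (c ⊔ ℓ)
∣ S ∣≡ k = Inverse S (setoid (Fin k))

infix 4 ∣_∣≡_

-- The sets counted by a^asc_{n,k}(132,321) and a^des_{n,k}(132,321).
𝒜asc 𝒜des : (n k : ℕ) → Setoid 0ℓ 0ℓ
𝒜asc n k = PermutationsWith {n} λ π →
  π Avoids p132 × π Avoids p321 × asc π ≡ k
𝒜des n k = PermutationsWith {n} λ π →
  π Avoids p132 × π Avoids p321 × des π ≡ k

{-# OPTIONS --safe #-}
-- A permutation avoiding 321 increases up to the position j of its minimum,
-- and one avoiding 132 increases from there on; so the only possible descent
-- ends at j, and des π is 0 or 1 according to whether j is the first position.
-- Avoiding both patterns, π is determined by j together with its first value v,
-- and for j , v > 0 the admissible pairs are those with j + v ≤ n, realised by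
-- the word v ⋯ (v+j−1) 0 ⋯ (v−1) (v+j) ⋯ (n−1).  There are n C 2 such pairs.
-- The ascent counts follow from asc π + des π = n − 1.
module Submission where

open import Defs
open import Data.Empty using (⊥; ⊥-elim)
open import Data.Fin using (Fin; zero; suc; inject₁; toℕ; fromℕ<; _<_)
open import Data.Fin.Induction using (<-weakInduction; <-wellFounded)
open import Data.Fin.Patterns using (0F; 1F; 2F)
open import Data.Fin.Permutation
  using (Permutation′; permutation; _⟨$⟩ʳ_; _⟨$⟩ˡ_; _≈_; cast-id; inverseˡ; inverseʳ)
import Data.Fin.Properties as Fin
open import Data.List using ([]; _∷_; allFin; filter; length)
open import Data.List.Membership.Propositional using (_∈_)
open import Data.List.Membership.Propositional.Properties using (∈-filter⁺; ∈-allFin)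
open import Data.List.Properties using (filter-none; length-tabulate)
open import Data.List.Relation.Unary.All as All using (All; []; _∷_)
open import Data.List.Relation.Unary.All.Properties using (all-filter)
open import Data.List.Relation.Unary.AllPairs using (_∷_)
open import Data.List.Relation.Unary.Unique.Propositional using (Unique)
import Data.List.Relation.Unary.Unique.Propositional.Properties as Unique
open import Data.Nat as ℕ using (ℕ; zero; suc; _+_; _≤_; _≥_; z≤n; s≤s; z<s)
open import Data.Nat.Combinatorics using (_C_; nC1≡n; nCk+nC[k+1]≡[n+1]C[k+1])
import Data.Nat.Properties as ℕ
open import Data.Product using (_×_; _,_; proj₁; proj₂; Σ; Σ-syntax; ∃-syntax)
open import Data.Sum using (_⊎_; inj₁; inj₂; [_,_]′)
open import Data.Sum.Function.Propositional using (_⊎-↔_)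
open import Function using (_∘_; _↔_; mk↔ₛ′; mk⇔; Inverse; Equivalence)
open import Function.Construct.Composition using (inverse)
open import Function.Properties.Bijection using (Bijection⇒Inverse)
open import Function.Properties.Inverse using (↔-refl; ↔-sym; ↔-trans)
open import Induction.WellFounded using (Acc; acc)
open import Level using (0ℓ)
open import Relation.Binary using (Setoid; tri<; tri≈; tri>)
open import Relation.Binary.PropositionalEquality
  using (_≡_; _≢_; refl; sym; trans; cong; cong₂; subst; subst₂; setoid)
open import Relation.Nullary using (¬_; yes; no; contradiction)
open import Relation.Unary using (Pred; Decidable)

private
  variable
    m n : ℕ
    i j k v w w′ x y : ℕ

-- Occurrences of 132 and 321

⟨$⟩ʳ-injective : (π : Permutation′ n) {a b : Fin n} → π ⟨$⟩ʳ a ≡ π ⟨$⟩ʳ b → a ≡ b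
⟨$⟩ʳ-injective π {a} {b} eq =
  trans (sym (inverseˡ π)) (trans (cong (π ⟨$⟩ˡ_) eq) (inverseˡ π))

-- One implication suffices: `ρ` is injective, so two distinct letters compare one way or the other,
-- and the opposite order in `ρ` would carry over to `π`.
contains : (π : Permutation′ n) (ρ : Permutation′ m) (ι : Fin m → Fin n) →
           (∀ a b → a < b → ι a < ι b) →
           (∀ a b → ρ ⟨$⟩ʳ a < ρ ⟨$⟩ʳ b → π ⟨$⟩ʳ ι a < π ⟨$⟩ʳ ι b) →
           π Contains ρ
contains π ρ ι mono order = ι , mono , λ a b → mk⇔ (reflect a b) (order a b)
  where
  reflect : ∀ a b → π ⟨$⟩ʳ ι a < π ⟨$⟩ʳ ι b → ρ ⟨$⟩ʳ a < ρ ⟨$⟩ʳ b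
  reflect a b lt with Fin.<-cmp (ρ ⟨$⟩ʳ a) (ρ ⟨$⟩ʳ b)
  ... | tri< ρa<ρb _ _ = ρa<ρb
  ... | tri≈ _ ρa≡ρb _ with refl ← ⟨$⟩ʳ-injective ρ ρa≡ρb = contradiction lt (ℕ.<-irrefl refl)
  ... | tri> _ _ ρb<ρa = contradiction lt (ℕ.<-asym (order b a ρb<ρa))

triple : Fin n → Fin n → Fin n → Fin 3 → Fin n
triple a b c 0F = a
triple a b c 1F = b
triple a b c 2F = c

triple-mono : {a b c : Fin n} → a < b → b < c →
              ∀ s t → s < t → triple a b c s < triple a b c t
triple-mono a<b b<c 0F 1F _ = a<b
triple-mono a<b b<c 0F 2F _ = ℕ.<-trans a<b b<c
triple-mono a<b b<c 1F 2F _ = b<c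
triple-mono a<b b<c 0F 0F ()
triple-mono a<b b<c 1F 0F ()
triple-mono a<b b<c 1F 1F (s≤s ())
triple-mono a<b b<c 2F 0F ()
triple-mono a<b b<c 2F 1F (s≤s ())
triple-mono a<b b<c 2F 2F (s≤s (s≤s ()))

No132 No321 : Permutation′ n → Set
No132 π = ∀ {a b c} → a < b → b < c →
          π ⟨$⟩ʳ a < π ⟨$⟩ʳ c → π ⟨$⟩ʳ c < π ⟨$⟩ʳ b → ⊥
No321 π = ∀ {a b c} → a < b → b < c →
          π ⟨$⟩ʳ c < π ⟨$⟩ʳ b → π ⟨$⟩ʳ b < π ⟨$⟩ʳ a → ⊥

avoids⇒no132 : (π : Permutation′ n) → π Avoids p132 → No132 π
avoids⇒no132 π av {a} {b} {c} a<b b<c πa<πc πc<πb =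
  av (contains π p132 (triple a b c) (triple-mono a<b b<c) order)
  where
  order : ∀ s t → p132 ⟨$⟩ʳ s < p132 ⟨$⟩ʳ t →
          π ⟨$⟩ʳ triple a b c s < π ⟨$⟩ʳ triple a b c t
  order 0F 1F _ = ℕ.<-trans πa<πc πc<πb
  order 0F 2F _ = πa<πc
  order 2F 1F _ = πc<πb
  order 0F 0F ()
  order 1F 0F ()
  order 1F 1F (s≤s (s≤s ()))
  order 1F 2F (s≤s ())
  order 2F 0F ()
  order 2F 2F (s≤s ())

avoids⇒no321 : (π : Permutation′ n) → π Avoids p321 → No321 π
avoids⇒no321 π av {a} {b} {c} a<b b<c πc<πb πb<πa =
  av (contains π p321 (triple a b c) (triple-mono a<b b<c) order)
  where
  order : ∀ s t → p321 ⟨$⟩ʳ s < p321 ⟨$⟩ʳ t →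
          π ⟨$⟩ʳ triple a b c s < π ⟨$⟩ʳ triple a b c t
  order 1F 0F _ = πb<πa
  order 2F 0F _ = ℕ.<-trans πc<πb πb<πa
  order 2F 1F _ = πc<πb
  order 0F 0F (s≤s (s≤s ()))
  order 0F 1F (s≤s ())
  order 0F 2F ()
  order 1F 1F (s≤s ())
  order 1F 2F ()
  order 2F 2F ()

no132⇒avoids : (π : Permutation′ n) → No132 π → π Avoids p132
no132⇒avoids π avoid (ι , mono , order) =
  avoid (mono 0F 1F z<s) (mono 1F 2F (s≤s z<s))
        (Equivalence.from (order 0F 2F) z<s) (Equivalence.from (order 2F 1F) (s≤s z<s))

no321⇒avoids : (π : Permutation′ n) → No321 π → π Avoids p321
no321⇒avoids π avoid (ι , mono , order) =
  avoid (mono 0F 1F z<s) (mono 1F 2F (s≤s z<s))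
        (Equivalence.from (order 2F 1F) z<s) (Equivalence.from (order 1F 0F) (s≤s z<s))

-- Permutations avoiding both patterns

first minPos : Permutation′ (suc n) → Fin (suc n)
first  π = π ⟨$⟩ʳ zero
minPos π = π ⟨$⟩ˡ zero

inject₁<suc : (i : Fin n) → inject₁ i < suc i
inject₁<suc i = s≤s (ℕ.≤-reflexive (Fin.toℕ-inject₁ i))

≢⇒0< : {a : Fin (suc n)} → a ≢ zero → zero {n} < a
≢⇒0< {a = zero}  a≢0 = contradiction refl a≢0
≢⇒0< {a = suc a} _   = z<s

module _ (π : Permutation′ (suc n)) where

  at-minPos : π ⟨$⟩ʳ minPos π ≡ zero
  at-minPos = inverseʳ π

  above-min : ∀ {a} → a ≢ minPos π → π ⟨$⟩ʳ minPos π < π ⟨$⟩ʳ a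
  above-min {a} a≢j rewrite at-minPos =
    ≢⇒0< λ πa≡0 → a≢j (trans (sym (inverseˡ π)) (cong (π ⟨$⟩ˡ_) πa≡0))

  first≡0⇒minPos≡0 : first π ≡ zero → minPos π ≡ zero
  first≡0⇒minPos≡0 eq = trans (cong (π ⟨$⟩ˡ_) (sym eq)) (inverseˡ π)

  minPos≡0⇒first≡0 : minPos π ≡ zero → first π ≡ zero
  minPos≡0⇒first≡0 eq = trans (cong (π ⟨$⟩ʳ_) (sym eq)) at-minPos

  ordered : ∀ {a b} → a < b → ¬ (π ⟨$⟩ʳ b < π ⟨$⟩ʳ a) → π ⟨$⟩ʳ a < π ⟨$⟩ʳ b
  ordered {a} {b} a<b ¬inv with Fin.<-cmp (π ⟨$⟩ʳ a) (π ⟨$⟩ʳ b)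
  ... | tri< lt _ _ = lt
  ... | tri≈ _ eq _ = contradiction a<b (Fin.<-irrefl (⟨$⟩ʳ-injective π eq))
  ... | tri> _ _ gt = contradiction gt ¬inv

  -- An inversion to the left of the minimum would form 321 with the minimum as its last letter.
  increasing-before : No321 π → ∀ {a b} → a < b → b < minPos π → π ⟨$⟩ʳ a < π ⟨$⟩ʳ b
  increasing-before no321 a<b b<j =
    ordered a<b (no321 a<b b<j (above-min (Fin.<⇒≢ b<j)))

  -- An inversion to the right of the minimum would form 132 with the minimum as its first letter;
  -- if `a` is itself the minimum position, minimality is enough.
  increasing-after : No132 π → ∀ {a b} → toℕ (minPos π) ≤ toℕ a → a < b →
                     π ⟨$⟩ʳ a < π ⟨$⟩ʳ b
  increasing-after no132 {a} {b} j≤a a<b with Fin._≟_ a (minPos π)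
  ... | yes refl = above-min (Fin.<⇒≢ a<b ∘ sym)
  ... | no a≢j   =
    ordered a<b (no132 (ℕ.≤∧≢⇒< j≤a (a≢j ∘ sym ∘ Fin.toℕ-injective)) a<b
                       (above-min (Fin.<⇒≢ (ℕ.≤-<-trans j≤a a<b) ∘ sym)))

  -- Before the minimum the values increase strictly, so each step gains at least one. This is the
  -- source of the constraint j + v ≤ n.
  first-bound : No321 π → ∀ i → i < minPos π → toℕ i + toℕ (first π) ≤ toℕ (π ⟨$⟩ʳ i)
  first-bound no321 =
    <-weakInduction (λ i → i < minPos π → toℕ i + toℕ (first π) ≤ toℕ (π ⟨$⟩ʳ i))
      (λ _ → ℕ.≤-refl)
      λ i ih si<j →
        let i<si = inject₁<suc i in
        ℕ.≤-trans
          (s≤s (subst (λ t → t + toℕ (first π) ≤ toℕ (π ⟨$⟩ʳ inject₁ i))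
                      (Fin.toℕ-inject₁ i) (ih (ℕ.<-trans i<si si<j))))
          (increasing-before no321 i<si si<j)

module _ (π σ : Permutation′ (suc n))
         (no321π : No321 π) (no132σ : No132 σ) (no321σ : No321 σ)
         (first≡ : first π ≡ first σ) (minPos≡ : minPos π ≡ minPos σ) where

  -- The value π i must occur in σ to the right of i, giving σ an inversion that
  -- the first value or the minimum completes to a forbidden pattern.
  not-below : ∀ i → (∀ {a} → a < i → π ⟨$⟩ʳ a ≡ σ ⟨$⟩ʳ a) → ¬ (π ⟨$⟩ʳ i < σ ⟨$⟩ʳ i)
  not-below i below πi<σi = compare (Fin.<-cmp (first σ) (π ⟨$⟩ʳ i))
    where
    p : Fin _
    p = σ ⟨$⟩ˡ (π ⟨$⟩ʳ i)

    σp≡πi : σ ⟨$⟩ʳ p ≡ π ⟨$⟩ʳ i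
    σp≡πi = inverseʳ σ

    σp<σi : σ ⟨$⟩ʳ p < σ ⟨$⟩ʳ i
    σp<σi = subst (_< _) (sym σp≡πi) πi<σi

    i<p : i < p
    i<p with Fin.<-cmp i p
    ... | tri< lt _ _ = lt
    ... | tri≈ _ eq _ = contradiction σp<σi (Fin.<-irrefl (cong (σ ⟨$⟩ʳ_) (sym eq)))
    -- To the left of `i` the two permutations agree, so `π` would take its value at `i` already at
    -- `p`.
    ... | tri> _ _ p<i =
      contradiction p<i (Fin.<-irrefl (⟨$⟩ʳ-injective π (trans (below p<i) σp≡πi)))

    0<i : zero {n} < i
    0<i = ≢⇒0< λ { refl → Fin.<-irrefl first≡ πi<σi }

    i≢minPosσ : i ≢ minPos σ
    i≢minPosσ i≡j with () ←
      subst (π ⟨$⟩ʳ i <_) (trans (cong (σ ⟨$⟩ʳ_) i≡j) (at-minPos σ)) πi<σi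

    compare : _ → ⊥
    compare (tri< v<πi _ _) =
      no132σ 0<i i<p (subst (first σ <_) (sym σp≡πi) v<πi) σp<σi
    compare (tri≈ _ v≡πi _) =
      Fin.<-irrefl (⟨$⟩ʳ-injective π (trans first≡ v≡πi)) 0<i
    compare (tri> _ _ πi<v) with Fin.<-cmp (minPos σ) i
    ... | tri< j<i _ _ = no132σ j<i i<p (above-min σ (Fin.<⇒≢ (ℕ.<-trans j<i i<p) ∘ sym)) σp<σi
    ... | tri≈ _ j≡i _ = i≢minPosσ (sym j≡i)
    -- This time the pattern lies in `π`: its first value, its value at `i` and its minimum form
    -- 321, since the minimum positions coincide.
    ... | tri> _ _ i<j = no321π 0<i (subst (i <_) (sym minPos≡) i<j)
                           (above-min π λ i≡j → i≢minPosσ (trans i≡j minPos≡))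
                           (subst (_ <_) (sym first≡) πi<v)

-- By strong induction on the position: given agreement to the left of `i`, neither value at `i` can
-- be the smaller one, by `not-below` in both directions.
determined : (π σ : Permutation′ (suc n)) → No132 π → No321 π → No132 σ → No321 σ →
             first π ≡ first σ → minPos π ≡ minPos σ → π ≈ σ
determined π σ no132π no321π no132σ no321σ first≡ minPos≡ i = go i (<-wellFounded i)
  where
  go : ∀ i → Acc _<_ i → π ⟨$⟩ʳ i ≡ σ ⟨$⟩ʳ i
  go i (acc rec) with Fin.<-cmp (π ⟨$⟩ʳ i) (σ ⟨$⟩ʳ i)
  ... | tri≈ _ eq _ = eq
  ... | tri< lt _ _ = contradiction lt
    (not-below π σ no321π no132σ no321σ first≡ minPos≡ i λ a<i → go _ (rec a<i))
  ... | tri> _ _ gt = contradiction gt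
    (not-below σ π no321σ no132π no321π (sym first≡) (sym minPos≡) i λ a<i → sym (go _ (rec a<i)))

-- Counting descents and ascents

-- Membership rules out the empty list, uniqueness a second entry.
length-unique-constant : ∀ {A : Set} {x : A} {xs} → Unique xs → All (_≡ x) xs → x ∈ xs →
                         length xs ≡ 1
length-unique-constant {xs = _ ∷ []}    _ _ _ = refl
length-unique-constant {xs = _ ∷ _ ∷ _} ((y≢z ∷ _) ∷ _) (y≡x ∷ z≡x ∷ _) _ =
  contradiction (trans y≡x (sym z≡x)) y≢z

count-one : {P : Pred (Fin n) 0ℓ} (P? : Decidable P) {a : Fin n} →
            P a → (∀ {b} → P b → b ≡ a) → length (filter P? (allFin n)) ≡ 1
count-one {n} P? Pa only =
  length-unique-constant (Unique.filter⁺ P? (Unique.allFin⁺ n))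
    (All.map only (all-filter P? (allFin n))) (∈-filter⁺ P? (∈-allFin _) Pa)

count-none : {P : Pred (Fin n) 0ℓ} (P? : Decidable P) →
             (∀ {b} → ¬ P b) → length (filter P? (allFin n)) ≡ 0
count-none {n} P? none = cong length (filter-none P? (All.universal (λ _ → none) (allFin n)))

length-filter-complement : {A : Set} {P Q : Pred A 0ℓ} (P? : Decidable P) (Q? : Decidable Q) →
  (∀ {x} → P x → ¬ Q x) → (∀ {x} → ¬ P x → Q x) →
  ∀ xs → length (filter P? xs) + length (filter Q? xs) ≡ length xs
length-filter-complement P? Q? disj cover [] = refl
length-filter-complement P? Q? disj cover (x ∷ xs)
  with ih ← length-filter-complement P? Q? disj cover xs | P? x | Q? x
... | yes Px | yes Qx = contradiction Qx (disj Px)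
... | yes _  | no _   = cong suc ih
... | no _   | yes _  = trans (ℕ.+-suc _ _) (cong suc ih)
... | no ¬Px | no ¬Qx = contradiction (cover ¬Px) ¬Qx

-- Adjacent values differ by injectivity, so each of the `n` adjacent pairs is either an ascent or a
-- descent.
asc+des≡n-1 : (π : Permutation′ (suc n)) → asc π + des π ≡ n
asc+des≡n-1 {n} π =
  trans (length-filter-complement _ _ ℕ.<-asym (λ {i} ¬asc →
           ℕ.≤∧≢⇒< (ℕ.≮⇒≥ ¬asc) λ eq →
             Fin.<-irrefl (⟨$⟩ʳ-injective π (Fin.toℕ-injective (sym eq))) (inject₁<suc i))
         (allFin n))
        (length-tabulate {n = n} (λ i → i))

-- A descent ending left of the minimum contradicts `increasing-before`; one ending right of it
-- starts at the minimum or later and contradicts `increasing-after`.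
descent-at-minPos : (π : Permutation′ (suc n)) → No132 π → No321 π →
                    ∀ {i} → π ⟨$⟩ʳ suc i < π ⟨$⟩ʳ inject₁ i → suc i ≡ minPos π
descent-at-minPos π no132 no321 {i} desc with Fin.<-cmp (suc i) (minPos π)
... | tri≈ _ eq _ = eq
... | tri< lt _ _ = contradiction desc (ℕ.<-asym (increasing-before π no321 (inject₁<suc i) lt))
... | tri> _ _ (s≤s j≤i) = contradiction desc
  (ℕ.<-asym (increasing-after π no132
     (ℕ.≤-trans j≤i (ℕ.≤-reflexive (sym (Fin.toℕ-inject₁ i)))) (inject₁<suc i)))

des-minPos-zero : (π : Permutation′ (suc n)) → No132 π → No321 π →
                  minPos π ≡ zero → des π ≡ 0
des-minPos-zero π no132 no321 j≡0 =
  count-none (λ i → π ⟨$⟩ʳ suc i Fin.<? π ⟨$⟩ʳ inject₁ i) λ desc →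
    contradiction (trans (descent-at-minPos π no132 no321 desc) j≡0) λ ()

-- The step into the minimum is a descent, and no other position can carry one.
des-minPos-suc : (π : Permutation′ (suc n)) → No132 π → No321 π →
                 ∀ {j} → minPos π ≡ suc j → des π ≡ 1
des-minPos-suc π no132 no321 {j} eq =
  count-one (λ i → π ⟨$⟩ʳ suc i Fin.<? π ⟨$⟩ʳ inject₁ i)
    (subst (λ t → π ⟨$⟩ʳ t < π ⟨$⟩ʳ inject₁ j) eq
      (above-min π λ ij≡min → Fin.<⇒≢ (inject₁<suc j) (trans ij≡min eq)))
    λ desc → Fin.suc-injective (trans (descent-at-minPos π no132 no321 desc) eq)

des≡0⇒minPos≡0 : (π : Permutation′ (suc n)) → No132 π → No321 π → des π ≡ 0 → minPos π ≡ zero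
des≡0⇒minPos≡0 π no132 no321 des≡0 with minPos π in eq
... | zero  = refl
... | suc _ = contradiction (trans (sym des≡0) (des-minPos-suc π no132 no321 eq)) λ ()

des≤1 : (π : Permutation′ (suc n)) → No132 π → No321 π → des π ≡ 0 ⊎ des π ≡ 1
des≤1 π no132 no321 with minPos π in eq
... | zero  = inj₁ (des-minPos-zero π no132 no321 eq)
... | suc _ = inj₂ (des-minPos-suc π no132 no321 eq)

-- Exchanging the first two blocks

-- The graph of the map exchanging the initial block of length j with the
-- following block of length v; flipping it exchanges the roles of j and v.
data Swap (j v : ℕ) (i w : ℕ) : Set where
  left  : i ℕ.< j → w ≡ i + v → Swap j v i w
  mid   : w ℕ.< v → i ≡ w + j → Swap j v i w
  right : j + v ≤ i → w ≡ i → Swap j v i w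

Swap-sym : Swap j v i w → Swap v j w i
Swap-sym         (left i<j w≡)  = mid i<j w≡
Swap-sym         (mid w<v i≡)   = left w<v i≡
Swap-sym {j} {v} {i} (right le refl) = right (subst (_≤ i) (ℕ.+-comm j v) le) refl

Swap-total : ∀ j v i → ∃[ w ] Swap j v i w
Swap-total j v i with i ℕ.<? j | i ℕ.<? j + v
... | yes i<j | _        = i + v , left i<j refl
... | no  i≮j | no i≮j+v = i , right (ℕ.≮⇒≥ i≮j+v) refl
-- In the second block i = j + t, and cancelling j in i < j + v gives t < v.
... | no  i≮j | yes i<j+v with t , refl ← ℕ.m≤n⇒∃[o]m+o≡n (ℕ.≮⇒≥ i≮j) =
  t , mid (ℕ.+-cancelˡ-< j t v i<j+v) (ℕ.+-comm j t)

j+v≤w+j⇒v≤w : ∀ j → j + v ≤ w + j → v ≤ w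
j+v≤w+j⇒v≤w {v} {w} j le = ℕ.+-cancelˡ-≤ j v w (subst (j + v ≤_) (ℕ.+-comm w j) le)

Swap-functional : Swap j v i w → Swap j v i w′ → w ≡ w′
Swap-functional (left _ refl) (left _ refl)  = refl
Swap-functional (left i<j _) (mid _ refl)   = contradiction (ℕ.m≤n+m _ _) (ℕ.<⇒≱ i<j)
Swap-functional (left i<j _) (right le _)   = contradiction (ℕ.m+n≤o⇒m≤o _ le) (ℕ.<⇒≱ i<j)
Swap-functional (mid _ refl) (left i<j _)   = contradiction (ℕ.m≤n+m _ _) (ℕ.<⇒≱ i<j)
Swap-functional {j} (mid _ refl) (mid _ eq) = ℕ.+-cancelʳ-≡ j _ _ eq
Swap-functional {j} (mid w<v refl) (right le _) =
  contradiction (j+v≤w+j⇒v≤w j le) (ℕ.<⇒≱ w<v)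
Swap-functional (right le _) (left i<j _)   = contradiction (ℕ.m+n≤o⇒m≤o _ le) (ℕ.<⇒≱ i<j)
Swap-functional {j} (right le _) (mid w<v refl) =
  contradiction (j+v≤w+j⇒v≤w j le) (ℕ.<⇒≱ w<v)
Swap-functional (right _ refl) (right _ refl) = refl

Swap-bound : j + v ≤ n → Swap j v i w → i ℕ.< n → w ℕ.< n
Swap-bound {v = v} h (left i<j refl) _ = ℕ.<-≤-trans (ℕ.+-monoˡ-< v i<j) h
Swap-bound {j} h (mid w<v _) _        = ℕ.<-≤-trans w<v (ℕ.m+n≤o⇒n≤o j h)
Swap-bound h (right _ refl) i<n       = i<n

Swap-left-≥ : Swap j v i w → i ℕ.< j → v ≤ w
Swap-left-≥ s i<j = ℕ.≤-trans (ℕ.m≤n+m _ _)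
  (ℕ.≤-reflexive (Swap-functional (left i<j refl) s))

-- Order is kept within each of the three blocks, and the third stays above the others, so only a
-- first-block entry against a second-block entry can be inverted.
Swap-inversion : Swap j v i x → Swap j v k y → i ℕ.< k → y ℕ.< x → i ℕ.< j × y ℕ.< v
Swap-inversion (left i<j _) (mid y<v _) _ _ = i<j , y<v
Swap-inversion {v = v} (left i<j refl) (left _ refl) i<k y<x =
  contradiction (ℕ.+-monoˡ-< v i<k) (ℕ.<-asym y<x)
Swap-inversion {j} {v} (left i<j refl) (right le refl) _ y<x =
  contradiction (ℕ.<-≤-trans (ℕ.+-monoˡ-< v i<j) le) (ℕ.<-asym y<x)
Swap-inversion (mid _ refl) (left k<j _) i<k _ =
  contradiction (ℕ.≤-<-trans (ℕ.m≤n+m _ _) (ℕ.<-trans i<k k<j)) (ℕ.<-irrefl refl)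
Swap-inversion {j} (mid _ refl) (mid _ refl) i<k y<x =
  contradiction (ℕ.+-monoˡ-< j y<x) (ℕ.<-asym i<k)
Swap-inversion {j} (mid x<v _) (right le refl) _ y<x =
  contradiction (ℕ.<-trans y<x x<v) (ℕ.≤⇒≯ (ℕ.m+n≤o⇒n≤o j le))
Swap-inversion (right le refl) (left k<j _) i<k _ =
  contradiction (ℕ.<-trans i<k k<j) (ℕ.≤⇒≯ (ℕ.m+n≤o⇒m≤o _ le))
Swap-inversion {j} {v} (right le refl) (mid y<v refl) i<k _ =
  contradiction (ℕ.<-≤-trans i<k (ℕ.≤-trans (ℕ.+-monoˡ-≤ j (ℕ.<⇒≤ y<v))
                                            (ℕ.≤-reflexive (ℕ.+-comm v j))))
                (ℕ.≤⇒≯ le)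
Swap-inversion (right _ refl) (right _ refl) i<k y<x = contradiction i<k (ℕ.<-asym y<x)

swap : ∀ j v → j + v ≤ n → Fin n → Fin n
swap j v h a = fromℕ< (Swap-bound h (proj₂ (Swap-total j v (toℕ a))) (Fin.toℕ<n a))

swap-Swap : ∀ j v (h : j + v ≤ n) a → Swap j v (toℕ a) (toℕ (swap j v h a))
swap-Swap j v h a =
  subst (Swap j v (toℕ a)) (sym (Fin.toℕ-fromℕ< _)) (proj₂ (Swap-total j v (toℕ a)))

-- Flipping the graph of `swap v j` gives the graph of `swap j v`, which is single-valued.
swap-inverse : ∀ j v (h : j + v ≤ n) (h′ : v + j ≤ n) a → swap j v h (swap v j h′ a) ≡ a
swap-inverse j v h h′ a = Fin.toℕ-injective
  (Swap-functional (swap-Swap j v h (swap v j h′ a)) (Swap-sym (swap-Swap v j h′ a)))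

-- Used for `swap j v` it yields the first value, and for the inverse `swap v j` the position of the
-- minimum.
swap-zero : ∀ j v (h : j + v ≤ suc n) → Swap j v 0 w → toℕ (swap j v h zero) ≡ w
swap-zero j v h = Swap-functional (swap-Swap j v h zero)

module _ (j v : ℕ) (h : j + v ≤ n) where

  swapPerm : Permutation′ n
  swapPerm = permutation (swap j v h) (swap v j h′)
                         (swap-inverse j v h h′) (swap-inverse v j h′ h)
    where h′ = subst (_≤ n) (ℕ.+-comm j v) h

  -- The inversion at `b`, `c` puts `b`, hence also `a`, in the first block, so the value at `a` is
  -- at least `v`, while the value at `c` is below `v`.
  swapPerm-no132 : No132 swapPerm
  swapPerm-no132 {a} {b} {c} a<b b<c σa<σc σc<σb =
    let b<j , σc<v = Swap-inversion (swap-Swap j v h b) (swap-Swap j v h c) b<c σc<σb in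
    ℕ.<⇒≱ (ℕ.<-trans σa<σc σc<v) (Swap-left-≥ (swap-Swap j v h a) (ℕ.<-trans a<b b<j))

  -- The middle letter would be the low end of one inversion, with value below `v`, and the high end
  -- of another, with value at least `v`.
  swapPerm-no321 : No321 swapPerm
  swapPerm-no321 {a} {b} {c} a<b b<c σc<σb σb<σa =
    let _   , σb<v = Swap-inversion (swap-Swap j v h a) (swap-Swap j v h b) a<b σb<σa
        b<j , _    = Swap-inversion (swap-Swap j v h b) (swap-Swap j v h c) b<c σc<σb in
    ℕ.<⇒≱ σb<v (Swap-left-≥ (swap-Swap j v h b) b<j)

-- The admissible pairs (j , v) = (suc a , suc b)

Cell : ℕ → Set
Cell n = Σ[ (a , b) ∈ ℕ × ℕ ] a + suc b ℕ.< n

cell≡ : {c d : Cell n} → proj₁ c ≡ proj₁ d → c ≡ d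
cell≡ {c = ab , _} refl = cong (ab ,_) (ℕ.≤-irrelevant _ _)

-- Cells with first coordinate zero leave `n` choices for the second; in all others the first
-- coordinate can be lowered by one.
Cell-suc : Cell (suc n) ↔ (Fin n ⊎ Cell n)
Cell-suc {n} = mk↔ₛ′ to from to∘from from∘to
  where
  to : Cell (suc n) → Fin n ⊎ Cell n
  to ((zero  , b) , s≤s lt) = inj₁ (fromℕ< lt)
  to ((suc a , b) , s≤s lt) = inj₂ ((a , b) , lt)

  from : Fin n ⊎ Cell n → Cell (suc n)
  from (inj₁ b)              = (zero , toℕ b) , s≤s (Fin.toℕ<n b)
  from (inj₂ ((a , b) , lt)) = (suc a , b) , s≤s lt

  to∘from : ∀ x → to (from x) ≡ x
  to∘from (inj₁ b) = cong inj₁ (Fin.fromℕ<-toℕ b _)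
  to∘from (inj₂ _) = refl

  from∘to : ∀ x → from (to x) ≡ x
  from∘to ((zero  , b) , s≤s lt) = cell≡ (cong (zero ,_) (Fin.toℕ-fromℕ< lt))
  from∘to ((suc a , b) , s≤s lt) = refl

n+nC2≡[1+n]C2 : ∀ n → n + n C 2 ≡ suc n C 2
n+nC2≡[1+n]C2 n = trans (cong (_+ n C 2) (sym (nC1≡n n))) (nCk+nC[k+1]≡[n+1]C[k+1] n 1)

-- The splitting of cells matches Pascal's rule, with n = n C 1.
Cell↔Fin : ∀ n → Cell n ↔ Fin (n C 2)
Cell↔Fin zero    = mk↔ₛ′ (λ ()) (λ ()) (λ ()) (λ ())
Cell↔Fin (suc n) =
  ↔-trans Cell-suc
    (↔-trans (↔-refl ⊎-↔ Cell↔Fin n)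
      (↔-trans (↔-sym Fin.+↔⊎) (cast-id (n+nC2≡[1+n]C2 n))))

-- Permutations with no descent and with one descent

∣𝒜des∣₀ : ∀ n → ∣ 𝒜des (suc n) 0 ∣≡ 1
∣𝒜des∣₀ n = Bijection⇒Inverse record
  { to        = λ _ → zero
  ; cong      = λ _ → refl
  ; bijective = (λ {x} {y} _ → unique x y)
              , λ { zero → (σ , no132⇒avoids σ no132 , no321⇒avoids σ no321 , des-σ) , λ _ → refl }
  }
  where
  open Setoid (𝒜des (suc n) 0) using (Carrier)

  σ : Permutation′ (suc n)
  -- Exchanging two empty blocks gives the identity.
  σ = swapPerm 0 0 z≤n

  no132 : No132 σ
  no132 = swapPerm-no132 0 0 z≤n

  no321 : No321 σ
  no321 = swapPerm-no321 0 0 z≤n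

  des-σ : des σ ≡ 0
  des-σ = des-minPos-zero σ no132 no321
    (Fin.toℕ-injective (swap-zero {n = n} 0 0 z≤n (right z≤n refl)))

  -- Without descents the minimum comes first, so both data required by `determined` are zero.
  unique : (x y : Carrier) → proj₁ x ≈ proj₁ y
  unique (π , π132 , π321 , π-des) (ρ , ρ132 , ρ321 , ρ-des) =
    determined π ρ noπ132 noπ321 noρ132 noρ321
      (trans (minPos≡0⇒first≡0 π π-min) (sym (minPos≡0⇒first≡0 ρ ρ-min)))
      (trans π-min (sym ρ-min))
    where
    noπ132 = avoids⇒no132 π π132
    noπ321 = avoids⇒no321 π π321
    noρ132 = avoids⇒no132 ρ ρ132
    noρ321 = avoids⇒no321 ρ ρ321
    π-min = des≡0⇒minPos≡0 π noπ132 noπ321 π-des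
    ρ-min = des≡0⇒minPos≡0 ρ noρ132 noρ321 ρ-des

-- A relation to the values alone, so that cells can be compared regardless of the avoidance and
-- descent proofs they were computed from.
HasCell : Permutation′ (suc n) → Cell (suc n) → Set
HasCell π ((a , b) , _) = toℕ (minPos π) ≡ suc a × toℕ (first π) ≡ suc b

cell : (π : Permutation′ (suc n)) → No132 π → No321 π → des π ≡ 1 → Σ (Cell (suc n)) (HasCell π)
cell π no132 no321 des≡1 with minPos π in j-eq | first π in v-eq
... | zero  | _    = contradiction (trans (sym des≡1) (des-minPos-zero π no132 no321 j-eq)) λ ()
... | suc j | zero = contradiction (trans (sym j-eq) (first≡0⇒minPos≡0 π v-eq)) λ ()
... | suc j | suc v = ((toℕ j , toℕ v) , ℕ.≤-<-trans bound (Fin.toℕ<n _))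
                    , cong toℕ j-eq , cong toℕ v-eq
  where
  -- `first-bound` at the position just before the minimum; the entry there is less than `suc n`,
  -- which gives the inequality of the cell.
  bound : toℕ j + suc (toℕ v) ≤ toℕ (π ⟨$⟩ʳ inject₁ j)
  bound = subst₂ (λ s t → s + toℕ t ≤ toℕ (π ⟨$⟩ʳ inject₁ j)) (Fin.toℕ-inject₁ j) v-eq
    (first-bound π no321 (inject₁ j) (subst (inject₁ j <_) (sym j-eq) (inject₁<suc j)))

HasCell-functional : (π ρ : Permutation′ (suc n)) → π ≈ ρ →
                     ∀ c d → HasCell π c → HasCell ρ d → c ≡ d
HasCell-functional π ρ π≈ρ _ _ (πj , πv) (ρj , ρv) = cell≡ (cong₂ _,_
    (ℕ.suc-injective (trans (sym πj) (trans (cong toℕ minPos≡) ρj)))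
    (ℕ.suc-injective (trans (sym πv) (trans (cong toℕ (π≈ρ zero)) ρv))))
  where
  minPos≡ : minPos π ≡ minPos ρ
  -- `minPos` uses the inverse map while `≈` compares forward values only, so injectivity of `ρ`
  -- bridges the two.
  minPos≡ = ⟨$⟩ʳ-injective ρ (trans (sym (π≈ρ _)) (trans (at-minPos π) (sym (at-minPos ρ))))

𝒜des₁↔Cell : ∀ n → Inverse (𝒜des (suc n) 1) (setoid (Cell (suc n)))
𝒜des₁↔Cell n = Bijection⇒Inverse record
  { to        = λ x → proj₁ (cellOf x)
  ; cong      = λ {x} {y} → cellOf-cong x y
  ; bijective = (λ {x} {y} → injective x y) , surjective
  }
  where
  open Setoid (𝒜des (suc n) 1) using (Carrier)

  cellOf : ((π , _) : Carrier) → Σ (Cell (suc n)) (HasCell π)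
  cellOf (π , π132 , π321 , π-des) =
    cell π (avoids⇒no132 π π132) (avoids⇒no321 π π321) π-des

  cellOf-cong : (x y : Carrier) → proj₁ x ≈ proj₁ y → proj₁ (cellOf x) ≡ proj₁ (cellOf y)
  cellOf-cong x y π≈ρ =
    HasCell-functional (proj₁ x) (proj₁ y) π≈ρ _ _ (proj₂ (cellOf x)) (proj₂ (cellOf y))

  injective : (x y : Carrier) → proj₁ (cellOf x) ≡ proj₁ (cellOf y) → proj₁ x ≈ proj₁ y
  injective x@(π , π132 , π321 , _) y@(ρ , ρ132 , ρ321 , _) eq
    with cellOf x | cellOf y
  injective x@(π , π132 , π321 , _) y@(ρ , ρ132 , ρ321 , _) refl
    | c , πj , πv | .c , ρj , ρv =
    determined π ρ (avoids⇒no132 π π132) (avoids⇒no321 π π321)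
                   (avoids⇒no132 ρ ρ132) (avoids⇒no321 ρ ρ321)
      (Fin.toℕ-injective (trans πv (sym ρv))) (Fin.toℕ-injective (trans πj (sym ρj)))

  surjective : ∀ c → Σ[ x ∈ Carrier ] (∀ {z} → proj₁ z ≈ proj₁ x → proj₁ (cellOf z) ≡ c)
  surjective c@((a , b) , lt) =
    (σ , no132⇒avoids σ no132 , no321⇒avoids σ no321 , des-σ (minPos σ) refl)
    , λ {z} z≈σ → HasCell-functional (proj₁ z) σ z≈σ _ c (proj₂ (cellOf z)) (σj , σv)
    where
    -- By definition of `<`, `lt` is already a proof of `suc a + suc b ≤ suc n`.
    σ = swapPerm (suc a) (suc b) lt

    no132 : No132 σ
    no132 = swapPerm-no132 (suc a) (suc b) lt

    no321 : No321 σ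
    no321 = swapPerm-no321 (suc a) (suc b) lt

    σj : toℕ (minPos σ) ≡ suc a
    σj = swap-zero (suc b) (suc a)
      (subst (_≤ suc n) (ℕ.+-comm (suc a) (suc b)) lt) (left z<s refl)

    σv : toℕ (first σ) ≡ suc b
    σv = swap-zero (suc a) (suc b) lt (left z<s refl)

    des-σ : ∀ j → minPos σ ≡ j → des σ ≡ 1
    des-σ zero    eq = contradiction (trans (sym σj) (cong toℕ eq)) λ ()
    des-σ (suc j) eq = des-minPos-suc σ no132 no321 eq

∣𝒜des∣₁ : ∀ n → ∣ 𝒜des (suc n) 1 ∣≡ suc n C 2
∣𝒜des∣₁ n = inverse (𝒜des₁↔Cell n) (Cell↔Fin (suc n))

-- Empty classes and the passage from descents to ascents

empty : {P : Permutation′ n → Set} → (∀ π → ¬ P π) → ∣ PermutationsWith P ∣≡ 0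
empty none = record
  { to        = λ (π , Pπ) → ⊥-elim (none π Pπ)
  ; from      = λ ()
  ; to-cong   = λ { {π , Pπ} _ → ⊥-elim (none π Pπ) }
  ; from-cong = λ { {()} }
  ; inverse   = (λ { {()} }) , λ { {π , Pπ} _ → ⊥-elim (none π Pπ) }
  }

-- Only the proof component changes, and `≈` ignores it, so every law is the identity on equations.
refine : {P Q : Permutation′ n → Set} → (∀ π → P π → Q π) → (∀ π → Q π → P π) →
         Inverse (PermutationsWith P) (PermutationsWith Q)
refine P⇒Q Q⇒P = record
  { to        = λ (π , Pπ) → π , P⇒Q π Pπ
  ; from      = λ (π , Qπ) → π , Q⇒P π Qπ
  ; to-cong   = λ eq → eq
  ; from-cong = λ eq → eq
  ; inverse   = (λ eq → eq) , λ eq → eq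
  }

-- Ascents and descents sum to `n`. The equation is written with `suc d` so that k + 1 and k + 2
-- equal to the length fit directly, with `d` being 0 and 1.
𝒜asc↔𝒜des : ∀ n k d → k + suc d ≡ suc n → Inverse (𝒜asc (suc n) k) (𝒜des (suc n) d)
𝒜asc↔𝒜des n k d eq = refine
  (λ { π (av , av′ , refl) → av , av′ , ℕ.+-cancelˡ-≡ k _ _ (trans (asc+des≡n-1 π) (sym k+d≡n)) })
  (λ { π (av , av′ , refl) → av , av′ , ℕ.+-cancelʳ-≡ d _ _ (trans (asc+des≡n-1 π) (sym k+d≡n)) })
  where
  k+d≡n : k + d ≡ n
  k+d≡n = ℕ.suc-injective (trans (sym (ℕ.+-suc k d)) eq)

proposition21 : ∀ (n k : ℕ) → n ≥ 1 →
    ( (k + 1 ≡ n → ∣ 𝒜asc n k ∣≡ 1)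
    × (k + 2 ≡ n → ∣ 𝒜asc n k ∣≡ n C 2)
    × (k + 1 ≢ n → k + 2 ≢ n → ∣ 𝒜asc n k ∣≡ 0) )
    ×
    ( (k ≡ 0 → ∣ 𝒜des n k ∣≡ 1)
    × (k ≡ 1 → ∣ 𝒜des n k ∣≡ n C 2)
    × (k ≢ 0 → k ≢ 1 → ∣ 𝒜des n k ∣≡ 0) )
proposition21 (suc n) k _ =
  ( (λ eq → inverse (𝒜asc↔𝒜des n k 0 eq) (∣𝒜des∣₀ n))
  , (λ eq → inverse (𝒜asc↔𝒜des n k 1 eq) (∣𝒜des∣₁ n))
  -- Matching on `refl` replaces `k` by `asc π`; `total` turns either possible descent count into an
  -- excluded equation.
  , λ k+1≢n k+2≢n → empty λ { π (av , av′ , refl) →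
      [ (λ des≡0 → k+1≢n (total π des≡0)) , (λ des≡1 → k+2≢n (total π des≡1)) ]′
      (des≤1 π (avoids⇒no132 π av) (avoids⇒no321 π av′)) } )
  ,
  ( (λ { refl → ∣𝒜des∣₀ n })
  , (λ { refl → ∣𝒜des∣₁ n })
  , λ k≢0 k≢1 → empty λ { π (av , av′ , refl) →
      [ k≢0 , k≢1 ]′ (des≤1 π (avoids⇒no132 π av) (avoids⇒no321 π av′)) } )
  where
  total : (π : Permutation′ (suc n)) → ∀ {d} → des π ≡ d → asc π + suc d ≡ suc n
  total π refl = trans (ℕ.+-suc (asc π) (des π)) (cong suc (asc+des≡n-1 π))
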